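{- Let $H=(h_1>\cdots>h_{p-1}>h_p=1)$ be a decreasing gap sequence with $p\ge2$, and put $b=h_{p-1}$. Write $n=qb+s$, where $q\ge1$ and $0\le s<b$ are integers. Then $$W_n(H)\ \ge\ q\binom b2+\binom s2\ \ge\ \frac{n(b-1)}4.$$ The same lower bound holds for $C_n(H)$.
   Context: Shellsort: a gap sequence is a decreasing sequence of positive integers $H=(h_1>h_2>\cdots>h_p=1)$. On an array of $n$ distinct keys (a permutation), pass $j$ runs ordinary insertion sort separately on each $h_j$-chain, i.e. on each set of positions with the same remainder modulo $h_j$: the key is repeatedly compared with the key $h_j$ positions before it, exchanging the two if they are out of order, until no exchange is needed or the start of the chain is reached. Passes are run for $j=1,2,\dots,p$. $W_n(H)$ and $C_n(H)$ are the worst-case (over all inputs of $n$ keys) total numbers of exchanges and of comparisons. -}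

module Defs where

open import Data.Fin.Base using (Fin; toℕ; fromℕ; fromℕ<; finToFun; inject₁)
  renaming (_<_ to _<ᶠ_)
open import Data.Fin.Properties using (_≟_; _<?_; toℕ<n)
open import Data.List.Base using (List; allFin; filter; foldl; map; upTo)
open import Data.List.Extrema.Nat using (max)
open import Data.Nat.Base using (ℕ; zero; suc; _<_; _∸_; NonZero)
open import Data.Nat.DivMod using (_/_; _%_)
import Data.Nat.Properties as ℕ
open import Data.Vec.Base using (Vec; lookup; tabulate; _[_]≔_)
open import Data.Vec.Relation.Unary.AllPairs using (allPairs?)
open import Data.Vec.Relation.Unary.Unique.Propositional using (Unique)
open import Relation.Binary.PropositionalEquality using (_≡_)
open import Relation.Nullary.Decidable using (Dec; yes; no; ¬?)

-- A gap sequence of p = suc p-1 gaps, indexed from 0: gap j is h_{j+1}.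
record GapSequence (p-1 : ℕ) : Set where
  field
    gap         : Fin (suc p-1) → ℕ
    positive    : ∀ j → NonZero (gap j)
    decreasing  : ∀ {i j} → i <ᶠ j → gap j < gap i
    last-is-one : gap (fromℕ p-1) ≡ 1

open GapSequence public

-- h_{p-1}, for a sequence of p = suc (suc p-2) ≥ 2 gaps.
penultimate : ∀ {p-2} → GapSequence (suc p-2) → ℕ
penultimate {p-2} H = gap H (inject₁ (fromℕ p-2))

unique? : ∀ {m n} (a : Vec (Fin m) n) → Dec (Unique a)
unique? = allPairs? (λ x y → ¬? (x ≟ y))

-- Every vector in (Fin n)ⁿ occurs (once) before filtering, since finToFun
-- enumerates all functions Fin n → Fin n.
permutations : (n : ℕ) → List (Vec (Fin n) n)
permutations n = filter unique? (map (λ c → tabulate (finToFun {n} {n} c)) (allFin _))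

record State (n : ℕ) : Set where
  constructor state
  field
    array       : Vec (Fin n) n
    exchanges   : ℕ
    comparisons : ℕ

open State public

swap : ∀ {n} → Fin n → Fin n → Vec (Fin n) n → Vec (Fin n) n
swap i j a = (a [ i ]≔ lookup a j) [ j ]≔ lookup a i

-- Truncated at position 0; only used on positions i with h ≤ toℕ i.
back : ∀ {n} → ℕ → Fin n → Fin n
back h i = fromℕ< (ℕ.≤-<-trans (ℕ.m∸n≤m (toℕ i) h) (toℕ<n i))

-- k is the number of positions preceding i in its h-chain, i.e. toℕ i / h.
insert : ∀ {n} (h k : ℕ) → Fin n → State n → State n
insert h zero    i s = s
insert h (suc k) i (state a e c) with lookup a i <? lookup a (back h i)
... | yes _ = insert h k (back h i) (state (swap i (back h i) a) (suc e) (suc c))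
... | no  _ = state a e (suc c)

-- The positions congruent to r modulo h, in increasing order.
chain : (n h r : ℕ) .{{_ : NonZero h}} → List (Fin n)
chain n h r = filter (λ i → toℕ i % h ℕ.≟ r) (allFin n)

sortChain : ∀ {n} (h : ℕ) .{{_ : NonZero h}} → State n → ℕ → State n
sortChain {n} h s r = foldl (λ t i → insert h (toℕ i / h) i t) s (chain n h r)

pass : ∀ {n} (h : ℕ) .{{_ : NonZero h}} → State n → State n
pass h s = foldl (sortChain h) s (upTo h)

shellsort : ∀ {p-1 n} → GapSequence p-1 → Vec (Fin n) n → State n
shellsort H a = foldl (λ s j → pass (gap H j) {{positive H j}} s) (state a 0 0) (allFin _)

-- The default 0 of max is immaterial: permutations n is never empty.
worstExchanges : ∀ {p-1} → ℕ → GapSequence p-1 → ℕ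
worstExchanges n H = max 0 (map (λ a → exchanges (shellsort H a)) (permutations n))

worstComparisons : ∀ {p-1} → ℕ → GapSequence p-1 → ℕ
worstComparisons n H = max 0 (map (λ a → comparisons (shellsort H a)) (permutations n))

-- Reverse each of the consecutive blocks of length b = h_{p-1} (the last one may
-- have length s < b) of the identity permutation.  Entries at distance at least b
-- lie in different blocks, hence are in order, so the passes with gaps
-- h_1, …, h_{p-1} ≥ b change nothing.  In the final insertion sort the entry at
-- position i moves past exactly the i mod b entries before it in its block,
-- giving Σ_{i<n} (i mod b) = q (b choose 2) + (s choose 2) exchanges.  Every
-- exchange is preceded by its own comparison.
module Submission where

open import Defs
open import Data.Fin.Base using (Fin; zero; suc; toℕ; fromℕ; fromℕ<; inject₁; finToFun; funToFin)
  renaming (_<_ to _<ᶠ_; _≤_ to _≤ᶠ_)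
import Data.Fin.Properties as Fin
open import Data.Integer.Base using (+_; +≤+) renaming (_≤_ to _≤ℤ_)
import Data.Integer.Properties as ℤ
open import Data.List.Base using ([]; _∷_; allFin; foldl; map; upTo)
  renaming (tabulate to tabulateᴸ)
open import Data.List.Extrema.Nat using (max; xs≤max)
open import Data.List.Membership.Propositional using (_∈_)
open import Data.List.Membership.Propositional.Properties using (∈-allFin; ∈-filter⁺; ∈-map⁺)
open import Data.List.Properties using (filter-all)
import Data.List.Relation.Unary.All as All
open import Data.Nat.Base
  using (ℕ; zero; suc; _+_; _*_; _∸_; _≤_; _<_; _⊓_; NonZero; z≤n; s≤s; >-nonZero; z<s)
open import Data.Nat.Combinatorics using (_C_; nC1≡n; nCk+nC[k+1]≡[n+1]C[k+1])
open import Data.Nat.DivMod using (_%_) renaming (_/_ to _/ℕ_)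
import Data.Nat.DivMod as DivMod
import Data.Nat.Properties as ℕ
open import Data.Nat.Solver using (module +-*-Solver)
open import Data.Product.Base using (_×_; _,_; proj₂)
open import Data.Rational.Base using (_/_; toℚᵘ) renaming (_≤_ to _≤ℚ_)
open import Data.Rational.Properties using (toℚᵘ-cancel-≤; toℚᵘ-fromℚᵘ)
open import Data.Rational.Unnormalised.Base using (mkℚᵘ; *≤*)
import Data.Rational.Unnormalised.Properties as ℚᵘ
open import Data.Sum.Base using (inj₁; inj₂)
open import Data.Vec.Base using (Vec; lookup; tabulate; _[_]≔_)
open import Data.Vec.Properties
  using (lookup∘tabulate; lookup∘update; lookup∘update′; tabulate-cong)
open import Data.Vec.Relation.Unary.Unique.Propositional.Properties using (tabulate⁺)
open import Function.Base using (_∘_)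
open import Relation.Binary.Definitions using (tri<; tri≈; tri>)
open import Relation.Binary.PropositionalEquality
open import Relation.Nullary.Decidable using (yes; no)
open import Relation.Nullary.Negation using (contradiction)

-- Invariants of folds.

foldl-preserves : ∀ {A B : Set} (P : A → Set) {f : A → B → A} →
  (∀ s x → P s → P (f s x)) → ∀ xs {s} → P s → P (foldl f s xs)
foldl-preserves P step []       ps = ps
foldl-preserves P step (x ∷ xs) ps = foldl-preserves P step xs (step _ x ps)

-- The invariant is indexed by the number of elements consumed. The induction removes the first
-- element and shifts both `P` and `g` by `suc`.
foldl-tabulate : ∀ {A B : Set} {n} (P : ℕ → A → Set) {f : A → B → A} (g : Fin n → B) →
  (∀ i s → P (toℕ i) s → P (suc (toℕ i)) (f s (g i))) →
  ∀ {s} → P 0 s → P n (foldl f s (tabulateᴸ g))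
foldl-tabulate {n = zero}  P g step p0 = p0
foldl-tabulate {n = suc n} P g step p0 =
  foldl-tabulate (P ∘ suc) (g ∘ suc) (step ∘ suc) (step zero _ p0)

-- Quotients, residues and the sum of residues.

quotient-unique : ∀ {k v} b .{{_ : NonZero b}} → k * b ≤ v → v < suc k * b → v /ℕ b ≡ k
quotient-unique {k} {v} b lo hi = ℕ.≤-antisym
  (ℕ.≤-pred (DivMod.m<n*o⇒m/o<n hi))
  (subst (_≤ v /ℕ b) (DivMod.m*n/n≡m k b) (DivMod./-monoˡ-≤ b lo))

quotient*-≤ : ∀ v b .{{_ : NonZero b}} → v /ℕ b * b ≤ v
quotient*-≤ v b = subst (v /ℕ b * b ≤_) (sym (DivMod.m≡m%n+[m/n]*n v b)) (ℕ.m≤n+m _ _)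

<-suc-quotient* : ∀ v b .{{_ : NonZero b}} → v < suc (v /ℕ b) * b
<-suc-quotient* v b = subst (_< suc (v /ℕ b) * b) (sym (DivMod.m≡m%n+[m/n]*n v b))
  (ℕ.+-monoˡ-< (v /ℕ b * b) (DivMod.m%n<n v b))

-- Adding 1 either raises the residue by 1 or wraps it to 0, hence an inequality. It lets one
-- exchange pay for one step to the left.
suc%≤ : ∀ k b .{{_ : NonZero b}} → suc k % b ≤ suc (k % b)
suc%≤ k b = begin
  suc k % b                      ≡⟨ cong (λ m → suc m % b) (DivMod.m≡m%n+[m/n]*n k b) ⟩
  (suc (k % b) + k /ℕ b * b) % b ≡⟨ DivMod.[m+kn]%n≡m%n (suc (k % b)) (k /ℕ b) b ⟩
  suc (k % b) % b                ≤⟨ DivMod.m%n≤m _ b ⟩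
  suc (k % b)                    ∎
  where open ℕ.≤-Reasoning

-- If `suc k` had residue `suc r`, then `k` would lie `r` above the same multiple of `b` and so have
-- the same quotient.
new-quotient⇒%≡0 : ∀ k b .{{_ : NonZero b}} → k /ℕ b ≢ suc k /ℕ b → suc k % b ≡ 0
new-quotient⇒%≡0 k b k/b≢ with suc k % b in eq
... | zero  = refl
... | suc r = contradiction
  (quotient-unique b
    (subst (suc k /ℕ b * b ≤_) (sym k≡) (ℕ.m≤n+m _ r))
    (ℕ.<-trans (ℕ.n<1+n k) (<-suc-quotient* (suc k) b)))
  k/b≢
  where
  k≡ : k ≡ r + suc k /ℕ b * b
  k≡ = ℕ.suc-injective (trans (DivMod.m≡m%n+[m/n]*n (suc k) b) (cong (_+ suc k /ℕ b * b) eq))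

residueSum : (b : ℕ) .{{_ : NonZero b}} → ℕ → ℕ
residueSum b zero    = 0
residueSum b (suc k) = residueSum b k + k % b

[1+n]C2≡nC2+n : ∀ n → suc n C 2 ≡ n C 2 + n
[1+n]C2≡nC2+n n = begin
  suc n C 2       ≡⟨ nCk+nC[k+1]≡[n+1]C[k+1] n 1 ⟨
  n C 1 + n C 2   ≡⟨ cong (_+ n C 2) (nC1≡n n) ⟩
  n + n C 2       ≡⟨ ℕ.+-comm n _ ⟩
  n C 2 + n       ∎
  where open ≡-Reasoning

residueSum-closed : ∀ b .{{_ : NonZero b}} q s → s ≤ b →
  residueSum b (q * b + s) ≡ q * (b C 2) + s C 2
residueSum-closed b zero    zero _ = refl
residueSum-closed b (suc q) zero _ = begin
  residueSum b (suc q * b + 0)  ≡⟨ cong (residueSum b) (ℕ.+-identityʳ (suc q * b)) ⟩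
  residueSum b (b + q * b)      ≡⟨ cong (residueSum b) (ℕ.+-comm b (q * b)) ⟩
  residueSum b (q * b + b)      ≡⟨ residueSum-closed b q b ℕ.≤-refl ⟩
  q * (b C 2) + b C 2           ≡⟨ ℕ.+-comm (q * (b C 2)) _ ⟩
  suc q * (b C 2)               ≡⟨ ℕ.+-identityʳ _ ⟨
  suc q * (b C 2) + 0           ∎
  where open ≡-Reasoning
residueSum-closed b q (suc s) s<b = begin
  residueSum b (q * b + suc s)                  ≡⟨ cong (residueSum b) (ℕ.+-suc (q * b) s) ⟩
  residueSum b (q * b + s) + (q * b + s) % b    ≡⟨ cong₂ _+_ (residueSum-closed b q s (ℕ.<⇒≤ s<b)) residue ⟩
  q * (b C 2) + s C 2 + s                       ≡⟨ ℕ.+-assoc (q * (b C 2)) _ s ⟩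
  q * (b C 2) + (s C 2 + s)                     ≡⟨ cong (_+_ (q * (b C 2))) ([1+n]C2≡nC2+n s) ⟨
  q * (b C 2) + suc s C 2                       ∎
  where
  open ≡-Reasoning
  residue : (q * b + s) % b ≡ s
  residue = trans (cong (_% b) (ℕ.+-comm (q * b) s))
    (trans (DivMod.[m+kn]%n≡m%n s q b) (DivMod.m<n⇒m%n≡m s<b))

-- Swaps, and exchanges bounded by comparisons.

toℕ-back : ∀ {n} h (i : Fin n) → toℕ (back h i) ≡ toℕ i ∸ h
toℕ-back h i = Fin.toℕ-fromℕ< _

module _ {n} {i j : Fin n} (i≢j : i ≢ j) (a : Vec (Fin n) n) where

  lookup-swap₁ : lookup (swap i j a) i ≡ lookup a j
  lookup-swap₁ = trans (lookup∘update′ i≢j (a [ i ]≔ lookup a j) _) (lookup∘update i a _)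

  lookup-swap₂ : lookup (swap i j a) j ≡ lookup a i
  lookup-swap₂ = lookup∘update j (a [ i ]≔ lookup a j) _

  lookup-swap-other : ∀ {l} → l ≢ i → l ≢ j → lookup (swap i j a) l ≡ lookup a l
  lookup-swap-other l≢i l≢j = trans (lookup∘update′ l≢j (a [ i ]≔ lookup a j) _) (lookup∘update′ l≢i a _)

Counted : ∀ {n} → State n → Set
Counted s = exchanges s ≤ comparisons s

insert-counted : ∀ {n} h k (i : Fin n) s → Counted s → Counted (insert h k i s)
insert-counted h zero    i s             e≤c = e≤c
insert-counted h (suc k) i (state a e c) e≤c with lookup a i Fin.<? lookup a (back h i)
... | yes _ = insert-counted h k _ _ (s≤s e≤c)
... | no  _ = ℕ.m≤n⇒m≤1+n e≤c

pass-counted : ∀ {n} h .{{_ : NonZero h}} (s : State n) → Counted s → Counted (pass h s)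
pass-counted {n} h s = foldl-preserves Counted
  (λ t r → foldl-preserves Counted (λ u i → insert-counted h (toℕ i /ℕ h) i u) (chain n h r)) (upTo h)

shellsort-counted : ∀ {p-1 n} (H : GapSequence p-1) (a : Vec (Fin n) n) →
  Counted (shellsort H a)
shellsort-counted H a = foldl-preserves Counted
  (λ s j → pass-counted (gap H j) {{positive H j}} s) (allFin _) {state a 0 0} z≤n

-- Passes that change nothing.

-- Asking for distance at least `h`, rather than exactly `h`, makes the property pass to larger
-- gaps, so one proof for `b` covers every gap before the last.
_SortedFromDistance_ : ∀ {n} → Vec (Fin n) n → ℕ → Set
a SortedFromDistance h = ∀ i j → toℕ i + h ≤ toℕ j → lookup a i <ᶠ lookup a j

module _ {n} {a₀ : Vec (Fin n) n} {h} .{{_ : NonZero h}} (sorted : a₀ SortedFromDistance h) where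

  -- The bound on `k` forces `h ≤ toℕ i` whenever a comparison is made. Then `back h i` is not
  -- truncated and lies exactly `h` before `i`, so the two entries are already in order.
  insert-unchanged : ∀ k i s → k ≤ toℕ i /ℕ h → array s ≡ a₀ → array (insert h k i s) ≡ a₀
  insert-unchanged zero    i s             _   eq   = eq
  insert-unchanged (suc k) i (state _ e c) k<q refl with lookup a₀ i Fin.<? lookup a₀ (back h i)
  ... | no  _ = refl
  ... | yes p = contradiction p (ℕ.<-asym (sorted (back h i) i
    (ℕ.≤-reflexive (trans (cong (_+ h) (toℕ-back h i)) (ℕ.m∸n+n≡m h≤i)))))
    where
    h≤i : h ≤ toℕ i
    h≤i = ℕ.≤-trans (ℕ.m≤n*m h (toℕ i /ℕ h) {{>-nonZero (ℕ.<-≤-trans z<s k<q)}})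
                    (quotient*-≤ (toℕ i) h)

  pass-unchanged : ∀ s → array s ≡ a₀ → array (pass h s) ≡ a₀
  pass-unchanged s = foldl-preserves ((_≡ a₀) ∘ array)
    (λ t r → foldl-preserves ((_≡ a₀) ∘ array)
      (λ u i → insert-unchanged (toℕ i /ℕ h) i u ℕ.≤-refl) (chain n h r)) (upTo h)

SortedFromDistance-mono : ∀ {n} {a : Vec (Fin n) n} {h h′} → h ≤ h′ →
  a SortedFromDistance h → a SortedFromDistance h′
SortedFromDistance-mono h≤h′ sorted i j le =
  sorted i j (ℕ.≤-trans (ℕ.+-monoʳ-≤ (toℕ i) h≤h′) le)

-- Final insertion sort of a block-reversed array.

block : (b : ℕ) .{{_ : NonZero b}} → ∀ {n} → Fin n → ℕ
block b i = toℕ i /ℕ b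

record BlockReversed {n} (b : ℕ) .{{_ : NonZero b}} (a : Vec (Fin n) n) : Set where
  field
    same-block : ∀ i → block b (lookup a i) ≡ block b i
    descending : ∀ {i j} → i <ᶠ j → block b i ≡ block b j → lookup a j <ᶠ lookup a i

block-<⇒< : ∀ {n b} .{{_ : NonZero b}} {i j : Fin n} → block b i < block b j → i <ᶠ j
block-<⇒< {b = b} bi<bj = ℕ.≰⇒> (λ j≤i → ℕ.<⇒≱ bi<bj (DivMod./-monoˡ-≤ b j≤i))

module _ {n b} .{{_ : NonZero b}} {a₀ : Vec (Fin n) n} (rev : BlockReversed b a₀) where
  open BlockReversed rev

  reversed-sorted : a₀ SortedFromDistance b
  reversed-sorted i j i+b≤j = block-<⇒< {b = b} (begin-strict
    block b (lookup a₀ i)  ≡⟨ same-block i ⟩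
    block b i              <⟨ ℕ.n<1+n _ ⟩
    suc (block b i)        ≡⟨ DivMod.m*n/n≡m (suc (block b i)) b ⟨
    suc (block b i) * b /ℕ b ≤⟨ DivMod./-monoˡ-≤ b (begin
      b + block b i * b      ≡⟨ ℕ.+-comm b _ ⟩
      block b i * b + b      ≤⟨ ℕ.+-monoˡ-≤ b (quotient*-≤ (toℕ i) b) ⟩
      toℕ i + b              ≤⟨ i+b≤j ⟩
      toℕ j                  ∎) ⟩
    block b j              ≡⟨ same-block j ⟨
    block b (lookup a₀ j)  ∎)
    where open ℕ.≤-Reasoning

  -- This asks less than a sorted prefix. For the count it is enough that each inserted entry
  -- exceeds every entry of its block still to come, in whichever order the inserted entries stand.
  record Inserted (k : ℕ) (a : Vec (Fin n) n) : Set where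
    field
      blocks    : ∀ j → block b (lookup a j) ≡ block b j
      untouched : ∀ j → k ≤ toℕ j → lookup a j ≡ lookup a₀ j
      larger    : ∀ j l → toℕ j < k → k ≤ toℕ l → block b j ≡ block b l →
                  lookup a₀ l <ᶠ lookup a j

  -- The entry of a₀ at i is being inserted and is currently at position x.
  record Inserting (i x : Fin n) (a : Vec (Fin n) n) : Set where
    field
      x≤i       : x ≤ᶠ i
      x~i       : block b x ≡ block b i
      current   : lookup a x ≡ lookup a₀ i
      blocks    : ∀ j → block b (lookup a j) ≡ block b j
      untouched : ∀ j → i <ᶠ j → lookup a j ≡ lookup a₀ j
      larger    : ∀ j l → j ≤ᶠ i → j ≢ x → i ≤ᶠ l → block b j ≡ block b l →
                  lookup a₀ l <ᶠ lookup a j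

  inserted-start : Inserted 0 a₀
  inserted-start = record
    { blocks = same-block ; untouched = λ _ _ → refl ; larger = λ _ _ () }

  inserting-start : ∀ {i a} → Inserted (toℕ i) a → Inserting i i a
  inserting-start {i} inv = record
    { x≤i = ℕ.≤-refl ; x~i = refl ; current = untouched i ℕ.≤-refl ; blocks = blocks
    ; untouched = λ j i<j → untouched j (ℕ.<⇒≤ i<j)
    ; larger = λ j l j≤i j≢i → larger j l (ℕ.≤∧≢⇒< j≤i (j≢i ∘ Fin.toℕ-injective)) }
    where open Inserted inv

  -- Only position `x` is new. It holds the entry of `a₀` at `i`, which exceeds the later entries of
  -- its block because `a₀` descends there.
  inserting-stop : ∀ {i x a} → Inserting i x a → Inserted (suc (toℕ i)) a
  inserting-stop {i} {x} {a} inv = record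
    { blocks = blocks ; untouched = untouched ; larger = larger′ }
    where
    open Inserting inv
    larger′ : ∀ j l → toℕ j < suc (toℕ i) → i <ᶠ l → block b j ≡ block b l →
              lookup a₀ l <ᶠ lookup a j
    larger′ j l j≤i i<l j~l with j Fin.≟ x
    ... | yes refl = subst (lookup a₀ l <ᶠ_) (sym current) (descending i<l (trans (sym x~i) j~l))
    ... | no  j≢x  = larger j l (ℕ.≤-pred j≤i) j≢x (ℕ.<⇒≤ i<l) j~l

  -- Swapping inside one block preserves `blocks`, and the entry that moves from `y` to `x` was
  -- already known to be `larger`.
  inserting-step : ∀ {i x y a} → y <ᶠ x → block b y ≡ block b x →
    Inserting i x a → Inserting i y (swap x y a)
  inserting-step {i} {x} {y} {a} y<x y~x inv = record
    { x≤i = ℕ.≤-trans (ℕ.<⇒≤ y<x) x≤i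
    ; x~i = trans y~x x~i
    ; current = trans (lookup-swap₂ x≢y a) current
    ; blocks = blocks′
    ; untouched = λ j i<j → trans
        (lookup-swap-other x≢y a (≢-sym (Fin.<⇒≢ (ℕ.≤-<-trans x≤i i<j)))
                                 (≢-sym (Fin.<⇒≢ (ℕ.<-trans (ℕ.<-≤-trans y<x x≤i) i<j))))
        (untouched j i<j)
    ; larger = larger′ }
    where
    open Inserting inv
    x≢y : x ≢ y
    x≢y = ≢-sym (Fin.<⇒≢ y<x)
    blocks′ : ∀ j → block b (lookup (swap x y a) j) ≡ block b j
    blocks′ j with j Fin.≟ x | j Fin.≟ y
    ... | yes refl | _        = trans (cong (block b) (lookup-swap₁ x≢y a)) (trans (blocks y) y~x)
    ... | no _     | yes refl = trans (cong (block b) (lookup-swap₂ x≢y a)) (trans (blocks x) (sym y~x))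
    ... | no j≢x   | no j≢y   = trans (cong (block b) (lookup-swap-other x≢y a j≢x j≢y)) (blocks j)
    larger′ : ∀ j l → j ≤ᶠ i → j ≢ y → i ≤ᶠ l → block b j ≡ block b l →
              lookup a₀ l <ᶠ lookup (swap x y a) j
    larger′ j l j≤i j≢y i≤l j~l with j Fin.≟ x
    ... | yes refl = subst (lookup a₀ l <ᶠ_) (sym (lookup-swap₁ x≢y a))
                       (larger y l (ℕ.≤-trans (ℕ.<⇒≤ y<x) x≤i) (≢-sym x≢y) i≤l (trans y~x j~l))
    ... | no j≢x   = subst (lookup a₀ l <ᶠ_) (sym (lookup-swap-other x≢y a j≢x j≢y))
                       (larger j l j≤i j≢x i≤l j~l)

  -- Induction on the current position `k`. An exchange never crosses a block boundary, and the
  -- insertion cannot stop while the left neighbour is in the same block. Hence it stops only where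
  -- the residue is 0, having exchanged at least `k % b` times.
  insert-exchanges : ∀ k {i x a e c} → toℕ x ≡ k → Inserting i x a →
    let s = insert 1 k x (state a e c) in
    Inserted (suc (toℕ i)) (array s) × e + k % b ≤ exchanges s
  -- `0 * b` reduces to `0`, so the library fact reads `0 % b ≡ 0`.
  insert-exchanges zero {e = e} x≡k inv = inserting-stop inv ,
    ℕ.≤-reflexive (trans (cong (_+_ e) (DivMod.m*n%n≡0 0 b)) (ℕ.+-identityʳ e))
  insert-exchanges (suc k) {i} {x} {a} {e} {c} x≡k inv
    with lookup a x Fin.<? lookup a (back 1 x)
  ... | yes ax<ay with insert-exchanges k {e = suc e} {c = suc c} y≡k
                         (inserting-step y<x y~x inv)
    where
    open Inserting inv
    y≡k : toℕ (back 1 x) ≡ k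
    y≡k = trans (toℕ-back 1 x) (cong (_∸ 1) x≡k)
    y<x : back 1 x <ᶠ x
    y<x = ℕ.≤-reflexive (trans (cong suc y≡k) (sym x≡k))
    -- The smaller value at `x` lies in no later block than the value at `back 1 x`. As values lie
    -- in the blocks of their positions, this reverses the inequality given by the positions.
    y~x : block b (back 1 x) ≡ block b x
    y~x = ℕ.≤-antisym (DivMod./-monoˡ-≤ b (ℕ.<⇒≤ y<x))
      (subst₂ _≤_ (blocks x) (blocks (back 1 x)) (DivMod./-monoˡ-≤ b (ℕ.<⇒≤ ax<ay)))
  ...   | inv′ , le = inv′ , (begin
    e + suc k % b     ≤⟨ ℕ.+-monoʳ-≤ e (suc%≤ k b) ⟩
    e + suc (k % b)   ≡⟨ ℕ.+-suc e _ ⟩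
    suc e + k % b     ≤⟨ le ⟩
    _                 ∎)
    where open ℕ.≤-Reasoning
  insert-exchanges (suc k) {i} {x} {a} {e} x≡k inv | no ax≮ay =
    inserting-stop inv , ℕ.≤-reflexive
      (trans (cong (_+_ e) (new-quotient⇒%≡0 k b k/b≢)) (ℕ.+-identityʳ e))
    where
    open Inserting inv
    y≡k : toℕ (back 1 x) ≡ k
    y≡k = trans (toℕ-back 1 x) (cong (_∸ 1) x≡k)
    y<x : back 1 x <ᶠ x
    y<x = ℕ.≤-reflexive (trans (cong suc y≡k) (sym x≡k))
    k/b≢ : k /ℕ b ≢ suc k /ℕ b
    -- If the two positions shared a block, `larger` with `l = i` would put the entry being inserted
    -- below its left neighbour, and an exchange would follow.
    k/b≢ k~ = ax≮ay (subst (_<ᶠ lookup a (back 1 x)) (sym current)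
      (larger (back 1 x) i (ℕ.≤-trans (ℕ.<⇒≤ y<x) x≤i) (Fin.<⇒≢ y<x) ℕ.≤-refl
        (trans (cong (_/ℕ b) y≡k) (trans k~ (trans (cong (_/ℕ b) (sym x≡k)) x~i)))))

  chain-1 : chain n 1 0 ≡ allFin n
  chain-1 = filter-all (λ i → toℕ i % 1 ℕ.≟ 0)
    (All.universal (λ i → DivMod.n%1≡0 (toℕ i)) (allFin n))

  pass-1-exchanges : ∀ s → array s ≡ a₀ → residueSum b n ≤ exchanges (pass 1 s)
  -- `upTo 1` holds only the residue 0, so the pass is a single fold over `chain n 1 0`. Exchanges
  -- made earlier only add to the count, so `z≤n` starts the invariant.
  pass-1-exchanges s refl rewrite chain-1 = proj₂ (foldl-tabulate Done {step} (λ i → i)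
    done-step {s} (inserted-start , z≤n))
    where
    step : State n → Fin n → State n
    step t i = insert 1 (toℕ i /ℕ 1) i t
    Done : ℕ → State n → Set
    Done k t = Inserted k (array t) × residueSum b k ≤ exchanges t
    done-step : ∀ i t → Done (toℕ i) t → Done (suc (toℕ i)) (step t i)
    done-step i t (inv , le) rewrite DivMod.n/1≡n (toℕ i)
      with insert-exchanges (toℕ i) {e = exchanges t} {c = comparisons t} refl (inserting-start inv)
    ... | inv′ , le′ = inv′ , ℕ.≤-trans (ℕ.+-monoˡ-≤ (toℕ i % b) le) le′

  -- The last gap equals 1 only propositionally. With a variable `h` the equation can be matched
  -- even though the `NonZero` evidence depends on `h`.
  pass-last-exchanges : ∀ {h} .{{_ : NonZero h}} → h ≡ 1 → ∀ s → array s ≡ a₀ →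
    residueSum b n ≤ exchanges (pass h s)
  pass-last-exchanges refl = pass-1-exchanges

-- The whole sequence of passes.

penultimate≤gap : ∀ {p-2} (H : GapSequence (suc p-2)) {j} → toℕ j ≤ p-2 →
  penultimate H ≤ gap H j
penultimate≤gap {p-2} H {j} j≤ with ℕ.m≤n⇒m<n∨m≡n j≤
... | inj₁ j< = ℕ.<⇒≤ (decreasing H
  (subst (toℕ j <_) (sym (trans (Fin.toℕ-inject₁ _) (Fin.toℕ-fromℕ p-2))) j<))
... | inj₂ j≡ = ℕ.≤-reflexive (cong (gap H)
  (Fin.toℕ-injective (trans (Fin.toℕ-inject₁ _) (trans (Fin.toℕ-fromℕ p-2) (sym j≡)))))

shellsort-exchanges : ∀ {p-2 n} (H : GapSequence (suc p-2)) {a : Vec (Fin n) n} →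
  let instance nz = positive H (inject₁ (fromℕ p-2)) in
  BlockReversed (penultimate H) a → residueSum (penultimate H) n ≤ exchanges (shellsort H a)
shellsort-exchanges {p-2} {n} H {a} rev =
  proj₂ (foldl-tabulate Progress (λ j → j) progress-step {state a 0 0} ((λ _ → refl) , λ ())) refl
  where
  instance nz = positive H (inject₁ (fromℕ p-2))
  -- Here `k` passes are complete. The first `suc p-2` of them have gaps at least `b`; the bound on
  -- exchanges is claimed only after all `suc (suc p-2)`.
  Progress : ℕ → State n → Set
  Progress k s = (k ≤ suc p-2 → array s ≡ a) ×
                 (k ≡ suc (suc p-2) → residueSum (penultimate H) n ≤ exchanges s)
  progress-step : ∀ j s → Progress (toℕ j) s →
    Progress (suc (toℕ j)) (pass (gap H j) {{positive H j}} s)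
  progress-step j s (unchanged , _) =
    (λ j< → pass-unchanged {{positive H j}}
      (SortedFromDistance-mono {a = a} (penultimate≤gap H (ℕ.≤-pred j<)) (reversed-sorted rev))
      s (unchanged (ℕ.<⇒≤ j<))) ,
    (λ j≡ → pass-last-exchanges rev {{positive H j}}
      (trans (cong (gap H) (Fin.toℕ-injective
               (trans (ℕ.suc-injective j≡) (sym (Fin.toℕ-fromℕ (suc p-2))))))
             (last-is-one H))
      s (unchanged (ℕ.≤-reflexive (ℕ.suc-injective j≡))))

-- Membership in the list of inputs, and the maximum.

-- The code of `f` is `funToFin f`. Decoding it returns `f` pointwise, which becomes an equality of
-- vectors after `tabulate`.
tabulate∈permutations : ∀ {n} {f : Fin n → Fin n} → (∀ {i j} → f i ≡ f j → i ≡ j) →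
  tabulate f ∈ permutations n
tabulate∈permutations {n} {f} inj = ∈-filter⁺ unique?
  (subst (_∈ map (tabulate ∘ finToFun) (allFin _)) (tabulate-cong (Fin.finToFun-funToFin f))
    (∈-map⁺ (tabulate ∘ finToFun) (∈-allFin (funToFin f))))
  (tabulate⁺ inj)

max-map-upper : ∀ {A : Set} (f : A → ℕ) {x xs} → x ∈ xs → f x ≤ max 0 (map f xs)
max-map-upper f x∈xs = All.lookup (xs≤max 0 _) (∈-map⁺ f x∈xs)

-- The block reversal as a permutation.

module _ (n b : ℕ) .{{_ : NonZero b}} where

  -- The exclusive end of block `k`; the minimum with `n` cuts off a short last block.
  blockEnd : ℕ → ℕ
  blockEnd k = n ⊓ (suc k * b)

  reversedPosition : Fin n → ℕ
  reversedPosition i = blockEnd (block b i) ∸ suc (toℕ i % b)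

  -- The left side is `suc (toℕ i)` split by division, and `i` lies below both `n` and the next
  -- multiple of `b`. This keeps the subtraction in `reversedPosition` from truncating and its value
  -- from falling before the block.
  suc-%+start≤blockEnd : ∀ i → suc (toℕ i % b) + block b i * b ≤ blockEnd (block b i)
  suc-%+start≤blockEnd i = subst (λ m → suc m ≤ blockEnd (block b i))
    (DivMod.m≡m%n+[m/n]*n (toℕ i) b)
    (ℕ.⊓-glb (Fin.toℕ<n i) (<-suc-quotient* (toℕ i) b))

  suc-%≤blockEnd : ∀ i → suc (toℕ i % b) ≤ blockEnd (block b i)
  suc-%≤blockEnd i = ℕ.m+n≤o⇒m≤o _ (suc-%+start≤blockEnd i)

  reversedPosition<blockEnd : ∀ i → reversedPosition i < blockEnd (block b i)
  reversedPosition<blockEnd i = ℕ.∸-monoʳ-< z<s (suc-%≤blockEnd i)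

  blockReversal : Fin n → Fin n
  blockReversal i = fromℕ< (ℕ.<-≤-trans (reversedPosition<blockEnd i) (ℕ.m⊓n≤m n _))

  toℕ-blockReversal : ∀ i → toℕ (blockReversal i) ≡ reversedPosition i
  toℕ-blockReversal i = Fin.toℕ-fromℕ< _

  block-blockReversal : ∀ i → block b (blockReversal i) ≡ block b i
  block-blockReversal i = trans (cong (_/ℕ b) (toℕ-blockReversal i)) (quotient-unique b
    (ℕ.m+n≤o⇒m≤o∸n _ (subst (_≤ blockEnd (block b i)) (ℕ.+-comm (suc (toℕ i % b)) _)
      (suc-%+start≤blockEnd i)))
    (ℕ.<-≤-trans (reversedPosition<blockEnd i) (ℕ.m⊓n≤n n _)))

  -- Within a block, positions are ordered as their residues, and these are subtracted from a common
  -- end.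
  blockReversal-descending : ∀ {i j} → i <ᶠ j → block b i ≡ block b j →
    blockReversal j <ᶠ blockReversal i
  blockReversal-descending {i} {j} i<j i~j =
    subst₂ _<_ (sym (toℕ-blockReversal j)) (sym (toℕ-blockReversal i))
      (subst (λ k → reversedPosition j < blockEnd k ∸ suc (toℕ i % b)) (sym i~j)
        (ℕ.∸-monoʳ-< (s≤s i%<j%) (suc-%≤blockEnd j)))
    where
    i%<j% : toℕ i % b < toℕ j % b
    i%<j% = ℕ.+-cancelʳ-< (block b i * b) _ _ (subst₂ _<_
      (DivMod.m≡m%n+[m/n]*n (toℕ i) b)
      (trans (DivMod.m≡m%n+[m/n]*n (toℕ j) b) (cong (λ k → toℕ j % b + k * b) (sym i~j)))
      i<j)

  -- Equal images place `i` and `j` in one block, where the map is strictly decreasing.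
  blockReversal-injective : ∀ {i j} → blockReversal i ≡ blockReversal j → i ≡ j
  blockReversal-injective {i} {j} eq = go (Fin.<-cmp i j)
    where
    i~j : block b i ≡ block b j
    i~j = trans (sym (block-blockReversal i)) (trans (cong (block b) eq) (block-blockReversal j))
    go : _ → i ≡ j
    go (tri< i<j _ _) = contradiction (sym eq) (Fin.<⇒≢ (blockReversal-descending i<j i~j))
    go (tri≈ _ i≡j _) = i≡j
    go (tri> _ _ j<i) = contradiction eq (Fin.<⇒≢ (blockReversal-descending j<i (sym i~j)))

  blockReversal-reversed : BlockReversed b (tabulate blockReversal)
  blockReversal-reversed = record
    { same-block = λ i → trans (cong (block b) (lookup∘tabulate blockReversal i)) (block-blockReversal i)
    ; descending = λ {i} {j} i<j i~j → subst₂ _<ᶠ_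
        (sym (lookup∘tabulate blockReversal j)) (sym (lookup∘tabulate blockReversal i))
        (blockReversal-descending i<j i~j) }

-- Arithmetic of the second inequality.

2*[1+n]C2≡[1+n]*n : ∀ n → 2 * (suc n C 2) ≡ suc n * n
2*[1+n]C2≡[1+n]*n zero    = refl
2*[1+n]C2≡[1+n]*n (suc n) = begin
  2 * (suc (suc n) C 2)          ≡⟨ cong (2 *_) ([1+n]C2≡nC2+n (suc n)) ⟩
  2 * (suc n C 2 + suc n)        ≡⟨ ℕ.*-distribˡ-+ 2 (suc n C 2) (suc n) ⟩
  2 * (suc n C 2) + 2 * suc n    ≡⟨ cong (_+ 2 * suc n) (2*[1+n]C2≡[1+n]*n n) ⟩
  suc n * n + 2 * suc n          ≡⟨ solve 1 (λ n → (con 1 :+ n) :* n :+ con 2 :* (con 1 :+ n)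
                                      := (con 2 :+ n) :* (con 1 :+ n)) refl n ⟩
  suc (suc n) * suc n            ∎
  where
  open ≡-Reasoning
  open +-*-Solver

-- Since n ≤ (q + 1) b ≤ 2 q b, the term q (b C 2) alone suffices.
n[b-1]≤4B : ∀ {n q s} b → n ≡ q * b + s → 1 ≤ q → s < b →
  n * (b ∸ 1) ≤ (q * (b C 2) + s C 2) * 4
n[b-1]≤4B {q = q} {s} b@(suc c) refl 1≤q s<b = begin
  (q * b + s) * c               ≤⟨ ℕ.*-monoˡ-≤ c (ℕ.+-monoʳ-≤ (q * b) s≤qb) ⟩
  (q * b + q * b) * c           ≡⟨ solve 3 (λ q b c → (q :* b :+ q :* b) :* c
                                     := q :* (b :* c) :* con 2) refl q b c ⟩
  q * (b * c) * 2               ≡⟨ cong (λ m → q * m * 2) (2*[1+n]C2≡[1+n]*n c) ⟨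
  q * (2 * (b C 2)) * 2         ≡⟨ solve 2 (λ q t → q :* (con 2 :* t) :* con 2
                                     := q :* t :* con 4) refl q (b C 2) ⟩
  q * (b C 2) * 4               ≤⟨ ℕ.*-monoˡ-≤ 4 (ℕ.m≤m+n (q * (b C 2)) (s C 2)) ⟩
  (q * (b C 2) + s C 2) * 4     ∎
  where
  open ℕ.≤-Reasoning
  open +-*-Solver
  s≤qb : s ≤ q * b
  s≤qb = ℕ.≤-trans (ℕ.<⇒≤ s<b) (ℕ.m≤n*m b q {{>-nonZero 1≤q}})

-- For unnormalised rationals the order is cross-multiplication, so the comparison is made there and
-- carried back.
≤*4⇒/4≤ : ∀ m k → m ≤ k * 4 → (+ m) / 4 ≤ℚ (+ k) / 1
≤*4⇒/4≤ m k m≤4k = toℚᵘ-cancel-≤ (begin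
  -- `mkℚᵘ` stores the denominator minus one: 3 and 0 stand for 4 and 1.
  toℚᵘ ((+ m) / 4)  ≃⟨ toℚᵘ-fromℚᵘ (mkℚᵘ (+ m) 3) ⟩
  mkℚᵘ (+ m) 3      ≤⟨ *≤* (subst₂ _≤ℤ_ (sym (ℤ.*-identityʳ (+ m))) (ℤ.pos-* k 4) (+≤+ m≤4k)) ⟩
  mkℚᵘ (+ k) 0      ≃⟨ toℚᵘ-fromℚᵘ (mkℚᵘ (+ k) 0) ⟨
  toℚᵘ ((+ k) / 1)  ∎)
  where open ℚᵘ.≤-Reasoning

lemma3p4 : ∀ {p-2} (H : GapSequence (suc p-2)) (n q s : ℕ) →
  let b = penultimate H
      B = q * (b C 2) + s C 2
  in n ≡ q * b + s → 1 ≤ q → s < b →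
     (B ≤ worstExchanges n H) ×
     ((+ (n * (b ∸ 1))) / 4 ≤ℚ (+ B) / 1) ×
     (B ≤ worstComparisons n H)
lemma3p4 {p-2} H n q s n≡ 1≤q s<b =
  ℕ.≤-trans B≤exchanges (max-map-upper (exchanges ∘ shellsort H) a∈) ,
  ≤*4⇒/4≤ _ (q * (b C 2) + s C 2) (n[b-1]≤4B b n≡ 1≤q s<b) ,
  ℕ.≤-trans (ℕ.≤-trans B≤exchanges (shellsort-counted H a))
            (max-map-upper (comparisons ∘ shellsort H) a∈)
  where
  instance nz = positive H (inject₁ (fromℕ p-2))
  b = penultimate H
  -- This one input bounds both maxima from below.
  a = tabulate (blockReversal n b)
  a∈ : a ∈ permutations n
  a∈ = tabulate∈permutations (blockReversal-injective n b)
  B≤exchanges : q * (b C 2) + s C 2 ≤ exchanges (shellsort H a)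
  B≤exchanges = ℕ.≤-trans
    (ℕ.≤-reflexive (sym (trans (cong (residueSum b) n≡) (residueSum-closed b q s (ℕ.<⇒≤ s<b)))))
    (shellsort-exchanges H (blockReversal-reversed n b))
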